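{- Let $q$ be a prime power, let $k\ge 1$, and let $f(x_1,\dots,x_k)\in\mathbb{F}_q[x_1,\dots,x_k]$. For $\alpha\in\mathbb{F}_q^*$ and an integer $n\ge 0$, let $N_\alpha(n)$ be the number of coefficients of the polynomial $f^n$ that are equal to $\alpha$. Then there exist square matrices $\Phi_0,\Phi_1,\dots,\Phi_{q-1}$ with integer entries, all of the same size, and a column vector $v$ of integers, none of which depends on $\alpha$, such that for every $\alpha\in\mathbb{F}_q^*$ there is a row vector $u$ of integers with the following property. For any integer $n\geq 1$ with base $q$ expansion $n=a_0+a_1q+\cdots+a_rq^r$, $0\le a_i\le q-1$, we have $$N_\alpha(n)=u\,\Phi_{a_r}\Phi_{a_{r-1}}\cdots\Phi_{a_0}\,v.$$
   Context: $\mathbb{F}_q$ is the finite field with $q$ elements and $\mathbb{F}_q^*$ its set of nonzero elements. The number of coefficients of $f^n$ equal to $\alpha$ means the number of exponent vectors $\gamma\in\mathbb{N}^k$ ($\mathbb{N}=\{0,1,2,\dots\}$) such that the coefficient of $x_1^{\gamma_1}\cdots x_k^{\gamma_k}$ in $f^n$ is $\alpha$. -}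

module Defs where

open import Level using (Level; _⊔_) renaming (suc to lsuc)
open import Algebra.Bundles using (CommutativeRing)
import Algebra.Properties.Semiring.Sum as SemiringSum
open import Data.Empty using (⊥-elim)
open import Data.Fin using (Fin)
import Data.Fin.Properties as FinP
open import Data.Integer as ℤ using (ℤ)
import Data.Integer.Properties as ℤP
open import Data.List using (List; []; _∷_; [_]; map; length; filter; deduplicate; cartesianProductWith)
open import Data.List.Membership.Propositional using (_∈_)
open import Data.List.Membership.Propositional.Properties using (∈-filter⁺; ∈-filter⁻; ∈-deduplicate⁺)
open import Data.List.Relation.Unary.Any using (here; there)
open import Data.List.Relation.Unary.Unique.Propositional using (Unique)
import Data.List.Relation.Unary.Unique.Propositional.Properties as Unique
import Data.List.Relation.Unary.Unique.DecPropositional.Properties as DecUnique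
open import Data.Nat as ℕ using (ℕ; zero; suc; _^_)
open import Data.Nat.Primality using (Prime)
open import Data.Product using (∃₂; _×_; _,_; proj₁; proj₂)
open import Data.Vec using (Vec; zipWith; replicate)
import Data.Vec.Properties as VecP
open import Data.Vec.Functional using (Vector)
open import Function.Bundles using (Inverse; _⇔_; mk⇔)
open import Function.Properties.Inverse using (Inverse⇒Injection)
open import Relation.Binary.Definitions using (Decidable; DecidableEquality)
open import Relation.Binary.PropositionalEquality as ≡ using (_≡_)
open import Relation.Nullary using (yes; no)
open import Relation.Nullary.Decidable using (via-injection)

IsPrimePower : ℕ → Set
IsPrimePower q = ∃₂ λ p e → Prime p × 1 ℕ.≤ e × q ≡ p ^ e

record FiniteField (c ℓ : Level) (q : ℕ) : Set (lsuc (c ⊔ ℓ)) where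
  field
    commutativeRing : CommutativeRing c ℓ

  open CommutativeRing commutativeRing public

  field
    1≉0         : 1# ≉ 0#
    _⁻¹⟨_⟩      : ∀ x → x ≉ 0# → Carrier
    *-inverseʳ  : ∀ x (x≉0 : x ≉ 0#) → x * (x ⁻¹⟨ x≉0 ⟩) ≈ 1#
    enumeration : Inverse setoid (≡.setoid (Fin q))

  _≟_ : Decidable _≈_
  _≟_ = via-injection (Inverse⇒Injection enumeration) FinP._≟_

module Polynomials {c ℓ : Level} {q : ℕ} (F : FiniteField c ℓ q) (k : ℕ) where

  open FiniteField F

  -- The exponent vector γ stands for the monomial x₁^γ₁ ⋯ x_k^γ_k.
  Exponents : Set
  Exponents = Vec ℕ k

  _≟ᴱ_ : DecidableEquality Exponents
  _≟ᴱ_ = VecP.≡-dec ℕ._≟_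

  -- A polynomial is written as a formal sum of terms a·x^γ. Exponents may
  -- repeat and coefficients may vanish, so the polynomial denoted by the sum
  -- is its coefficient function `coeff` below, not the list itself.
  Poly : Set c
  Poly = List (Carrier × Exponents)

  coeff : Poly → Exponents → Carrier
  coeff []            γ = 0#
  coeff ((a , δ) ∷ f) γ with δ ≟ᴱ γ
  ... | yes _ = a + coeff f γ
  ... | no  _ = coeff f γ

  1ᴾ : Poly
  1ᴾ = [ 1# , replicate k 0 ]

  infixl 7 _*ᴾ_
  infixr 8 _^ᴾ_

  _*ᴾ_ : Poly → Poly → Poly
  _*ᴾ_ = cartesianProductWith λ (a , γ) (b , δ) → a * b , zipWith ℕ._+_ γ δ

  _^ᴾ_ : Poly → ℕ → Poly
  f ^ᴾ zero  = 1ᴾ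
  f ^ᴾ suc n = f *ᴾ f ^ᴾ n

  -- Only exponents occurring in the formal sum are examined. For α ≉ 0# this
  -- misses nothing (see ∈-exponentsWith and exponentsWith-unique); for
  -- α ≈ 0# the list is meaningless, the true count being infinite if k ≥ 1.
  exponentsWith : Carrier → Poly → List Exponents
  exponentsWith α f =
    filter (λ γ → coeff f γ ≟ α) (deduplicate _≟ᴱ_ (map proj₂ f))

  exponentsWith-unique : ∀ α f → Unique (exponentsWith α f)
  exponentsWith-unique α f =
    Unique.filter⁺ (λ γ → coeff f γ ≟ α)
      (DecUnique.deduplicate-! _≟ᴱ_ (map proj₂ f))

  private
    support : ∀ f γ → coeff f γ ≉ 0# → γ ∈ map proj₂ f
    support []            γ c≉0 = ⊥-elim (c≉0 refl)
    support ((a , δ) ∷ f) γ c≉0 with δ ≟ᴱ γ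
    ... | yes ≡.refl = here ≡.refl
    ... | no  _    = there (support f γ c≉0)

  ∈-exponentsWith : ∀ {α} → α ≉ 0# → ∀ f γ →
                    γ ∈ exponentsWith α f ⇔ coeff f γ ≈ α
  ∈-exponentsWith {α} α≉0 f γ = mk⇔
    (λ γ∈ → proj₂ (∈-filter⁻ (λ γ → coeff f γ ≟ α) {xs = deduplicate _≟ᴱ_ (map proj₂ f)} γ∈))
    (λ c≈α → ∈-filter⁺ (λ γ → coeff f γ ≟ α)
      (∈-deduplicate⁺ _≟ᴱ_ (support f γ λ c≈0 → α≉0 (trans (sym c≈α) c≈0)))
      c≈α)

  N : Poly → Carrier → ℕ → ℕ
  N f α n = length (exponentsWith α (f ^ᴾ n))

Matrix : ℕ → ℕ → Set
Matrix m n = Fin m → Fin n → ℤ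

infix  6 _∙ᵥ_
infixr 7 _*ᵥ_

-- Row vector times column vector.
_∙ᵥ_ : ∀ {n} → Vector ℤ n → Vector ℤ n → ℤ
u ∙ᵥ v = SemiringSum.sum ℤP.+-*-semiring λ i → u i ℤ.* v i

-- Matrix times column vector.
_*ᵥ_ : ∀ {m n} → Matrix m n → Vector ℤ n → Vector ℤ m
(A *ᵥ v) i = A i ∙ᵥ v

-- With digits listed from the least significant one, a₀ ∷ a₁ ∷ … ∷ a_r ∷ [],
-- this is Φ_{a_r} (⋯ (Φ_{a₁} (Φ_{a₀} v))).
digitAction : ∀ {q d} → (Fin q → Matrix d d) → List (Fin q) → Vector ℤ d → Vector ℤ d
digitAction Φ []       v = v
digitAction Φ (a ∷ as) v = digitAction Φ as (Φ a *ᵥ v)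

{-# OPTIONS --safe #-}
module Submission where

open import Defs
open import Level using (Level; _⊔_)
open import Algebra.Bundles using (CommutativeMonoid; CommutativeSemiring)
import Algebra.Properties.CommutativeMonoid.Sum as CommutativeMonoidSum
import Algebra.Properties.CommutativeSemigroup as CommutativeSemigroupProperties
import Algebra.Properties.CommutativeSemiring.Binomial as Binomial
import Algebra.Properties.CommutativeSemiring.Exp as Exp
import Algebra.Properties.Group as GroupProperties
import Algebra.Properties.Semiring.Mult as Mult
import Algebra.Properties.Semiring.Sum as SemiringSum
open import Data.Digit using (Expansion; fromDigits)
open import Data.Empty using (⊥-elim)
open import Data.Fin as Fin using (Fin; toℕ; inject₁; fromℕ; fromℕ<; punchIn; finToFun; funToFin)
open import Data.Fin.Permutation using (Permutation; permutation)
import Data.Fin.Properties as FinP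
open import Data.Integer as ℤ using (ℤ; +_)
import Data.Integer.Properties as ℤP
open import Data.List as List using (List; []; _∷_; _++_; length; concat; tabulate)
import Data.List.Properties as ListP
open import Data.List.Membership.Propositional using (_∈_)
open import Data.List.Membership.Propositional.Properties
  using (∈-map⁺; ∈-map⁻; ∈-concat⁺′; ∈-concat⁻′; ∈-tabulate⁺; ∈-tabulate⁻)
open import Data.List.Membership.Propositional.Properties.WithK using (unique∧set⇒bag)
open import Data.List.Relation.Binary.BagAndSetEquality using (∼bag⇒↭)
open import Data.List.Relation.Binary.Permutation.Propositional.Properties using (↭-length)
open import Data.List.Relation.Unary.All as All using (All; []; _∷_)
import Data.List.Relation.Unary.All.Properties as AllP
import Data.List.Relation.Unary.AllPairs.Properties as AllPairsP
open import Data.List.Relation.Unary.Unique.Propositional using (Unique)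
import Data.List.Relation.Unary.Unique.Propositional.Properties as Unique
open import Data.Nat as ℕ using (ℕ; zero; suc; _≤_; _<_; _!; NonZero)
open import Data.Nat.Combinatorics using (_C_; nCn≡1; nCk≡n!/k![n-k]!; k![n∸k]!∣n!)
open import Data.Nat.Divisibility as ∣ using (_∣_; divides; _∤_)
open import Data.Nat.DivMod
  using (_/_; _%_; m/n*n≡m; m≡m%n+[m/n]*n; m%n<n; m<n⇒m%n≡m; [m+kn]%n≡m%n)
open import Data.Nat.Primality using (Prime; euclidsLemma; ¬prime[0]; prime⇒nonTrivial)
import Data.Nat.Properties as ℕP
open import Data.Product using (_×_; _,_; Σ-syntax; ∃; proj₁; proj₂)
open import Data.Sum using ([_,_]′)
open import Data.Vec as Vec using (Vec; []; _∷_; zipWith; replicate; lookup)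
import Data.Vec.Properties as VecP
open import Data.Vec.Functional using (Vector; removeAt)
open import Function using (_∘_; Inverse; Equivalence; mk⇔; _⇔_)
import Relation.Binary.Reasoning.Setoid as SetoidReasoning
open import Relation.Binary.PropositionalEquality as ≡ using (_≡_; _≢_)
open import Relation.Nullary using (yes; no; Dec; ¬_)

-- By Frobenius, f^(a+mq)(x) g(x) = f^m(x^q) · f^a(x) g(x). Sorting the monomials
-- of f^a g by their exponents modulo q, f^a g = Σ_δ x^δ h_δ(x^q) with 0 ≤ δ_i < q,
-- so the number of coefficients α of f^(a+mq) g is the sum over δ of that number
-- for f^m h_δ. If E bounds the exponents of f and of g, it also bounds those of
-- the h_δ; hence only finitely many polynomials g occur, and they index the
-- matrices. The entry (h, g) of Φ_a counts the δ with h_δ = h, the vector v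
-- selects g = 1, and u lists the numbers of coefficients α of the g themselves.

-- The identity `f(x)^q = f(x^q)` needs two facts about the field: it has characteristic `p`, and
-- `a ^ q` equals `a`. The field is known only through an enumeration of its elements, so both come
-- from reindexing a sum or a product over it, along translation by 1 and along multiplication by
-- `a`. The obstacle is that polynomials are formal sums, many lists denoting the same polynomial.
-- Two equalities therefore coexist: `≋`, under which formal sums form a commutative semiring and
-- Frobenius can be proved, and equality of coefficients, which is all that is known of an h_δ once
-- it is recovered from its finite code. The first implies the second; instead of a converse,
-- `coeff-*ᴾ-transfer` multiplies by sums that are known only through their coefficients. It also
-- expresses why the recursion closes: a factor that is a polynomial in x^q leaves residues modulo
-- `q` alone, so it can be pulled out of each h_δ.

-- Binomial coefficients modulo a prime.

prime∤factorial : ∀ {p} → Prime p → ∀ n → n < p → p ∤ n !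
prime∤factorial p-prime zero    n<p p∣1 =
  ℕP.<⇒≢ (ℕ.nonTrivial⇒n>1 _ {{prime⇒nonTrivial p-prime}}) (≡.sym (∣.∣1⇒≡1 p∣1))
prime∤factorial p-prime (suc n) n<p p∣n! =
  [ (λ p∣1+n → ℕP.<⇒≱ n<p (∣.∣⇒≤ p∣1+n))
  , prime∤factorial p-prime n (ℕP.<-trans (ℕP.n<1+n n) n<p)
  ]′ (euclidsLemma (suc n) (n !) p-prime p∣n!)

-- Euclid's lemma on `p ! = (p C k) * (k ! * (p ∸ k) !)`: both factorials on the right are of
-- numbers below `p`, so only the binomial can absorb the factor `p`.
prime∣binomial : ∀ {p k} → Prime p → 1 ≤ k → k < p → p ∣ p C k
prime∣binomial {p@(suc p-1)} {k@(suc k-1)} p-prime 1≤k k<p =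
  [ (λ p∣C → p∣C)
  , (λ p∣d → ⊥-elim ([ prime∤factorial p-prime k k<p
                     , prime∤factorial p-prime (p ℕ.∸ k) (ℕP.∸-monoʳ-< 1≤k (ℕP.<⇒≤ k<p)) ]′
                     (euclidsLemma (k !) ((p ℕ.∸ k) !) p-prime p∣d)))
  ]′ (euclidsLemma (p C k) (k ! ℕ.* (p ℕ.∸ k) !) p-prime (≡.subst (p ∣_) (≡.sym C*d≡p!) (∣.m∣m*n (p-1 !))))
  where
  instance
    d≢0 : NonZero (k ! ℕ.* (p ℕ.∸ k) !)
    d≢0 = ℕP._!*_!≢0 k (p ℕ.∸ k)
  C*d≡p! : (p C k) ℕ.* (k ! ℕ.* (p ℕ.∸ k) !) ≡ p !
  C*d≡p! = ≡.trans (≡.cong (ℕ._* (k ! ℕ.* (p ℕ.∸ k) !)) (nCk≡n!/k![n-k]! (ℕP.<⇒≤ k<p)))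
                   (m/n*n≡m (k![n∸k]!∣n! (ℕP.<⇒≤ k<p)))

-- Additivity of p-power maps in characteristic p.

module Frobenius {c ℓ : Level} (S : CommutativeSemiring c ℓ) where
  open CommutativeSemiring S
  open Exp S
  open Mult semiring renaming (_×_ to _·_)
  open SemiringSum semiring
  open Binomial S using (binomialTerm; theorem)
  open SetoidReasoning setoid

  ∣⇒·≈0 : ∀ {p n} → p · 1# ≈ 0# → p ∣ n → ∀ x → n · x ≈ 0#
  ∣⇒·≈0 {p} p·1≈0 (divides k ≡.refl) x = begin
    (k ℕ.* p) · x         ≈⟨ ×-congʳ (k ℕ.* p) (*-identityˡ x) ⟨
    (k ℕ.* p) · (1# * x)  ≈⟨ ×-assoc-* (k ℕ.* p) 1# x ⟨
    ((k ℕ.* p) · 1#) * x  ≈⟨ *-congʳ (×1-homo-* k p) ⟩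
    (k · 1# * p · 1#) * x ≈⟨ *-congʳ (*-congˡ p·1≈0) ⟩
    (k · 1# * 0#) * x     ≈⟨ *-congʳ (zeroʳ _) ⟩
    0# * x                ≈⟨ zeroˡ x ⟩
    0#                    ∎

  -- All inner terms of the binomial theorem vanish by `prime∣binomial`. A semiring is the right
  -- generality because the lemma is applied to formal sums, which carry no negation here.
  ^p-homo-+ : ∀ {p} → Prime p → p · 1# ≈ 0# → ∀ x y → (x + y) ^ p ≈ x ^ p + y ^ p
  ^p-homo-+ {zero}      n-prime n·1≈0 x y = ⊥-elim (¬prime[0] n-prime)
  ^p-homo-+ {n@(suc m)} n-prime n·1≈0 x y = begin
    (x + y) ^ n
      ≈⟨ theorem n x y ⟩
    term Fin.zero + sum (λ i → term (Fin.suc i))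
      ≈⟨ +-cong first (sum-init-last (λ i → term (Fin.suc i))) ⟩
    y ^ n + (sum (λ i → term (Fin.suc (inject₁ i))) + term (Fin.suc (fromℕ m)))
      ≈⟨ +-congˡ (+-cong (trans (sum-cong-≋ middle) (sum-replicate-zero m)) final) ⟩
    y ^ n + (0# + x ^ n)
      ≈⟨ +-congˡ (+-identityˡ _) ⟩
    y ^ n + x ^ n
      ≈⟨ +-comm _ _ ⟩
    x ^ n + y ^ n
      ∎
    where
    term = binomialTerm x y n
    first : term Fin.zero ≈ y ^ n
    first = trans (×-homo-1 _) (*-identityˡ _)
    middle : ∀ i → term (Fin.suc (inject₁ i)) ≈ 0#
    middle i = ∣⇒·≈0 n·1≈0 (prime∣binomial n-prime (ℕ.s≤s ℕ.z≤n)
      (ℕ.s≤s (≡.subst (_< m) (≡.sym (FinP.toℕ-inject₁ i)) (FinP.toℕ<n i)))) _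
    final : term (Fin.suc (fromℕ m)) ≈ x ^ n
    final rewrite FinP.toℕ-fromℕ m | nCn≡1 n | ℕP.n∸n≡0 n =
      trans (×-homo-1 _) (*-identityʳ _)

  ^pᵉ-homo-+ : ∀ {p} → Prime p → p · 1# ≈ 0# → ∀ e x y →
               (x + y) ^ (p ℕ.^ e) ≈ x ^ (p ℕ.^ e) + y ^ (p ℕ.^ e)
  ^pᵉ-homo-+ p-prime p·1≈0 zero x y =
    trans (*-identityʳ _) (sym (+-cong (*-identityʳ _) (*-identityʳ _)))
  ^pᵉ-homo-+ {p} p-prime p·1≈0 (suc e) x y = begin
    (x + y) ^ (p ℕ.* pᵉ)            ≈⟨ ^-assocʳ (x + y) p pᵉ ⟨
    ((x + y) ^ p) ^ pᵉ              ≈⟨ ^-congˡ pᵉ (^p-homo-+ p-prime p·1≈0 x y) ⟩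
    (x ^ p + y ^ p) ^ pᵉ            ≈⟨ ^pᵉ-homo-+ p-prime p·1≈0 e (x ^ p) (y ^ p) ⟩
    (x ^ p) ^ pᵉ + (y ^ p) ^ pᵉ     ≈⟨ +-cong (^-assocʳ x p pᵉ) (^-assocʳ y p pᵉ) ⟩
    x ^ (p ℕ.* pᵉ) + y ^ (p ℕ.* pᵉ) ∎
    where pᵉ = p ℕ.^ e

-- Finite fields: the characteristic and Fermat's identity.

module FieldProperties {c ℓ : Level} {q : ℕ} (F : FiniteField c ℓ q) where
  open FiniteField F
  open Exp commutativeSemiring using (_^_; ^-congˡ)
  open Mult semiring using (×1-homo-*; ×-homo-1) renaming (_×_ to _·_)
  open SetoidReasoning setoid
  private
    module ∑ = CommutativeMonoidSum +-commutativeMonoid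
    module ∏ = CommutativeMonoidSum *-commutativeMonoid

  open Inverse enumeration public using ()
    renaming (to to index; from to element; to-cong to index-cong;
              strictlyInverseˡ to index-element; strictlyInverseʳ to element-index)

  -- Sums and products over the field are indexed by `Fin q`, so a bijection of the carrier must
  -- become a permutation of indices before it can reindex them.
  permuteElements : (f g : Carrier → Carrier) → (∀ {x y} → x ≈ y → f x ≈ f y) →
                    (∀ {x y} → x ≈ y → g x ≈ g y) →
                    (∀ x → f (g x) ≈ x) → (∀ x → g (f x) ≈ x) → Permutation q q
  permuteElements f g f-cong g-cong fg gf =
    permutation (index ∘ f ∘ element) (index ∘ g ∘ element)
      (λ i → ≡.trans (index-cong (trans (f-cong (element-index _)) (fg _))) (index-element i))
      (λ i → ≡.trans (index-cong (trans (g-cong (element-index _)) (gf _))) (index-element i))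

  -- Translation by 1 permutes the field, so the sum S of all elements satisfies S = S + q · 1.
  q·1≈0 : q · 1# ≈ 0#
  q·1≈0 = GroupProperties.identityʳ-unique +-group (∑.sum element) (q · 1#) (begin
    ∑.sum element + q · 1#                    ≈⟨ +-congˡ (∑.sum-replicate q) ⟨
    ∑.sum element + ∑.sum {q} (λ _ → 1#)      ≈⟨ ∑.∑-distrib-+ element (λ _ → 1#) ⟨
    ∑.sum (λ i → element i + 1#)              ≈⟨ ∑.sum-cong-≋ (λ i → element-index (element i + 1#)) ⟨
    ∑.sum (λ i → element (index (element i + 1#))) ≈⟨ ∑.sum-permute element shift ⟨
    ∑.sum element                             ∎)
    where
    shift = permuteElements (_+ 1#) (_+ - 1#) +-congʳ +-congʳ
      (λ x → trans (+-assoc x _ _) (trans (+-congˡ (-‿inverseˡ 1#)) (+-identityʳ x)))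
      (λ x → trans (+-assoc x _ _) (trans (+-congˡ (-‿inverseʳ 1#)) (+-identityʳ x)))

  *-cancelˡ-≉0 : ∀ {a} → a ≉ 0# → ∀ {x y} → a * x ≈ a * y → x ≈ y
  *-cancelˡ-≉0 {a} a≉0 {x} {y} ax≈ay = begin
    x             ≈⟨ a⁻¹a x ⟨
    a⁻¹ * (a * x) ≈⟨ *-congˡ ax≈ay ⟩
    a⁻¹ * (a * y) ≈⟨ a⁻¹a y ⟩
    y             ∎
    where
    a⁻¹ = a ⁻¹⟨ a≉0 ⟩
    a⁻¹a : ∀ x → a⁻¹ * (a * x) ≈ x
    a⁻¹a x = trans (sym (*-assoc _ _ _))
               (trans (*-congʳ (trans (*-comm _ _) (*-inverseʳ a a≉0))) (*-identityˡ x))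

  *-≉0 : ∀ {x y} → x ≉ 0# → y ≉ 0# → x * y ≉ 0#
  *-≉0 x≉0 y≉0 xy≈0 = y≉0 (*-cancelˡ-≉0 x≉0 (trans xy≈0 (sym (zeroʳ _))))

  ∏-≉0 : ∀ {n} (t : Fin n → Carrier) → (∀ i → t i ≉ 0#) → ∏.sum t ≉ 0#
  ∏-≉0 {zero}  t t≉0 = 1≉0
  ∏-≉0 {suc n} t t≉0 = *-≉0 (t≉0 Fin.zero) (∏-≉0 (t ∘ Fin.suc) (t≉0 ∘ Fin.suc))

  -- `p ^ e` times 1 is the `e`-th power of `p` times 1, and a field has no nonzero nilpotents.
  pᵉ·1≈0⇒p·1≈0 : ∀ p e → (p ℕ.^ e) · 1# ≈ 0# → p · 1# ≈ 0#
  pᵉ·1≈0⇒p·1≈0 p zero    1·1≈0 = ⊥-elim (1≉0 (trans (sym (×-homo-1 1#)) 1·1≈0))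
  pᵉ·1≈0⇒p·1≈0 p (suc e) pᵉ·1≈0 with (p · 1#) ≟ 0#
  ... | yes p≈0 = p≈0
  ... | no  p≉0 = pᵉ·1≈0⇒p·1≈0 p e (*-cancelˡ-≉0 p≉0 (begin
    p · 1# * (p ℕ.^ e) · 1#  ≈⟨ ×1-homo-* p (p ℕ.^ e) ⟨
    (p ℕ.* p ℕ.^ e) · 1#     ≈⟨ pᵉ·1≈0 ⟩
    0#                       ≈⟨ zeroʳ _ ⟨
    p · 1# * 0#              ∎))

  private
    ifZero : Carrier → Carrier → Carrier → Carrier
    ifZero y z x with x ≟ 0#
    ... | yes _ = y
    ... | no  _ = z

    ifZero-yes : ∀ {y z x} → x ≈ 0# → ifZero y z x ≈ y
    ifZero-yes {x = x} x≈0 with x ≟ 0#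
    ... | yes _   = refl
    ... | no  x≉0 = ⊥-elim (x≉0 x≈0)

    ifZero-no : ∀ {y z x} → x ≉ 0# → ifZero y z x ≈ z
    ifZero-no {x = x} x≉0 with x ≟ 0#
    ... | yes x≈0 = ⊥-elim (x≉0 x≈0)
    ... | no  _   = refl

  -- The extra `a` on the left makes up for the factor 1 at `z`; this avoids the exponent `n ∸ 1`.
  ∏-off-0 : ∀ {n} (t : Fin n → Carrier) (z : Fin n) (a : Carrier) →
            t z ≈ 1# → (∀ i → i ≢ z → t i ≈ a) → a * ∏.sum t ≈ a ^ n
  ∏-off-0 {suc n} t z a tz≈1 t≈a = *-congˡ (begin
    ∏.sum t                       ≈⟨ ∏.sum-remove {i = z} t ⟩
    t z * ∏.sum (removeAt t z)
      ≈⟨ *-cong tz≈1 (∏.sum-cong-≋ λ i → t≈a (punchIn z i) (FinP.punchInᵢ≢i z i)) ⟩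
    1# * ∏.sum {n} (λ _ → a)      ≈⟨ *-identityˡ _ ⟩
    ∏.sum {n} (λ _ → a)           ≈⟨ ∏.sum-replicate n ⟩
    a ^ n                         ∎)

  -- Multiplication by a permutes the nonzero elements, so their product ∏φ is
  -- unchanged by the factor a^(q-1) that it picks up. To have products over all
  -- of Fin q, the element 0 contributes the factor 1 to ∏φ and to ∏ψ.
  fermat : ∀ a → a ^ q ≈ a
  fermat a with a ≟ 0#
  ... | yes a≈0 = trans (^-congˡ q a≈0) (trans (0^ q (index 0#)) (sym a≈0))
    where
    -- The inhabitant of `Fin n` excludes the exponent 0, for which the power would be 1.
    0^ : ∀ n → Fin n → 0# ^ n ≈ 0#
    0^ (suc n) _ = zeroˡ _
  ... | no  a≉0 = begin
    a ^ q             ≈⟨ ∏-off-0 ψ (index 0#) a (ifZero-yes (element-index 0#)) ψ-off-0 ⟨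
    a * ∏.sum ψ       ≈⟨ *-congˡ ∏ψ≈1 ⟩
    a * 1#            ≈⟨ *-identityʳ a ⟩
    a                 ∎
    where
    φ ψ : Fin q → Carrier
    φ i = ifZero 1# (element i) (element i)
    ψ i = ifZero 1# a (element i)

    π = permuteElements (a *_) (a ⁻¹⟨ a≉0 ⟩ *_) *-congˡ *-congˡ
          (λ x → trans (sym (*-assoc _ _ _)) (trans (*-congʳ (*-inverseʳ a a≉0)) (*-identityˡ x)))
          (λ x → trans (sym (*-assoc _ _ _))
             (trans (*-congʳ (trans (*-comm _ _) (*-inverseʳ a a≉0))) (*-identityˡ x)))

    ψ-off-0 : ∀ i → i ≢ index 0# → ψ i ≈ a
    ψ-off-0 i i≢z = ifZero-no λ x≈0 → i≢z (≡.trans (≡.sym (index-element i)) (index-cong x≈0))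

    φ≉0 : ∀ i → φ i ≉ 0#
    φ≉0 i with element i ≟ 0#
    ... | yes _   = 1≉0
    ... | no  x≉0 = x≉0

    φπ : ∀ i → φ (index (a * element i)) ≈ φ i * ψ i
    φπ i with element i ≟ 0#
    ... | yes x≈0 = trans (ifZero-yes (trans (element-index _) (trans (*-congˡ x≈0) (zeroʳ a))))
                      (sym (*-identityˡ 1#))
    ... | no  x≉0 = trans (ifZero-no λ ax≈0 → *-≉0 a≉0 x≉0 (trans (sym (element-index _)) ax≈0))
                      (trans (element-index _) (*-comm a _))

    ∏ψ≈1 : ∏.sum ψ ≈ 1#
    ∏ψ≈1 = *-cancelˡ-≉0 (∏-≉0 φ φ≉0) (begin
      ∏.sum φ * ∏.sum ψ                      ≈⟨ ∏.∑-distrib-+ φ ψ ⟨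
      ∏.sum (λ i → φ i * ψ i)                ≈⟨ ∏.sum-cong-≋ φπ ⟨
      ∏.sum (λ i → φ (index (a * element i))) ≈⟨ ∏.sum-permute φ π ⟨
      ∏.sum φ                                ≈⟨ *-identityʳ _ ⟨
      ∏.sum φ * 1#                           ∎)

-- Arithmetic of exponent vectors.

infixl 6 _⊕_
_⊕_ : ∀ {k} → Vec ℕ k → Vec ℕ k → Vec ℕ k
_⊕_ = zipWith ℕ._+_

scale : ∀ {k} → ℕ → Vec ℕ k → Vec ℕ k
scale n = Vec.map (n ℕ.*_)

module _ {k : ℕ} where
  ⊕-comm : (γ δ : Vec ℕ k) → γ ⊕ δ ≡ δ ⊕ γ
  ⊕-comm = VecP.zipWith-comm ℕP.+-comm

  ⊕-assoc : (γ δ ε : Vec ℕ k) → (γ ⊕ δ) ⊕ ε ≡ γ ⊕ (δ ⊕ ε)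
  ⊕-assoc = VecP.zipWith-assoc ℕP.+-assoc

  ⊕-identityˡ : (γ : Vec ℕ k) → replicate k 0 ⊕ γ ≡ γ
  ⊕-identityˡ = VecP.zipWith-identityˡ (λ _ → ≡.refl)

⊕-cancelˡ : ∀ {k} (γ : Vec ℕ k) {δ ε} → γ ⊕ δ ≡ γ ⊕ ε → δ ≡ ε
⊕-cancelˡ []      {[]}    {[]}    _  = ≡.refl
⊕-cancelˡ (x ∷ γ) {y ∷ δ} {z ∷ ε} eq =
  ≡.cong₂ _∷_ (ℕP.+-cancelˡ-≡ x y z (VecP.∷-injectiveˡ eq)) (⊕-cancelˡ γ (VecP.∷-injectiveʳ eq))

scale-zero : ∀ {k} (γ : Vec ℕ k) → scale 0 γ ≡ replicate k 0
scale-zero []      = ≡.refl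
scale-zero (x ∷ γ) = ≡.cong (0 ∷_) (scale-zero γ)

scale-suc : ∀ {k} n (γ : Vec ℕ k) → scale (suc n) γ ≡ γ ⊕ scale n γ
scale-suc n []      = ≡.refl
scale-suc n (x ∷ γ) = ≡.cong (_ ∷_) (scale-suc n γ)

scale-⊕ : ∀ {k} n (γ δ : Vec ℕ k) → scale n (γ ⊕ δ) ≡ scale n γ ⊕ scale n δ
scale-⊕ n []      []      = ≡.refl
scale-⊕ n (x ∷ γ) (y ∷ δ) = ≡.cong₂ _∷_ (ℕP.*-distribˡ-+ n x y) (scale-⊕ n γ δ)

scale-replicate-0 : ∀ k n → scale n (replicate k 0) ≡ replicate k 0
scale-replicate-0 zero    n = ≡.refl
scale-replicate-0 (suc k) n = ≡.cong₂ _∷_ (ℕP.*-zeroʳ n) (scale-replicate-0 k n)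

-- Decides whether x^ε divides x^γ; if not, x^ε times any polynomial has coefficient 0 at `γ`.
∃-⊕? : ∀ {k} (ε γ : Vec ℕ k) → Dec (∃ λ δ → γ ≡ ε ⊕ δ)
∃-⊕? []      []      = yes ([] , ≡.refl)
∃-⊕? (x ∷ ε) (y ∷ γ) with x ℕ.≤? y | ∃-⊕? ε γ
... | yes x≤y | yes (δ , γ≡) = yes (y ℕ.∸ x ∷ δ , ≡.cong₂ _∷_ (≡.sym (ℕP.m+[n∸m]≡n x≤y)) γ≡)
... | no  x≰y | _ = no λ { (z ∷ δ , eq) →
  x≰y (≡.subst (x ≤_) (≡.sym (VecP.∷-injectiveˡ eq)) (ℕP.m≤m+n x z)) }
... | yes _ | no  ∄δ = no λ { (z ∷ δ , eq) → ∄δ (δ , VecP.∷-injectiveʳ eq) }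

-- The semiring of formal sums and the Frobenius identity.

module PolynomialProperties {c ℓ : Level} {q : ℕ} (F : FiniteField c ℓ q) (k : ℕ) where
  open FiniteField F hiding (zero)
  open FieldProperties F
  open Polynomials F k
  open SetoidReasoning setoid
  open Exp commutativeSemiring using (_^_)
  private module +Semi =
            CommutativeSemigroupProperties (CommutativeMonoid.commutativeSemigroup +-commutativeMonoid)

  -- The linear functional taking x^γ to `φ γ`. It is a plain fold over the list, so like terms
  -- never have to be collected.
  ⟨_,_⟩ : Poly → (Exponents → Carrier) → Carrier
  ⟨ []          , φ ⟩ = 0#
  ⟨ (a , γ) ∷ f , φ ⟩ = a * φ γ + ⟨ f , φ ⟩

  ⟨⟩-cong : ∀ f {φ ψ} → (∀ γ → φ γ ≈ ψ γ) → ⟨ f , φ ⟩ ≈ ⟨ f , ψ ⟩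
  ⟨⟩-cong []            φ≈ψ = refl
  ⟨⟩-cong ((a , γ) ∷ f) φ≈ψ = +-cong (*-congˡ (φ≈ψ γ)) (⟨⟩-cong f φ≈ψ)

  ⟨⟩-++ : ∀ f g φ → ⟨ f ++ g , φ ⟩ ≈ ⟨ f , φ ⟩ + ⟨ g , φ ⟩
  ⟨⟩-++ []            g φ = sym (+-identityˡ _)
  ⟨⟩-++ ((a , γ) ∷ f) g φ = trans (+-congˡ (⟨⟩-++ f g φ)) (sym (+-assoc _ _ _))

  ⟨⟩-zero : ∀ f → ⟨ f , (λ _ → 0#) ⟩ ≈ 0#
  ⟨⟩-zero []            = refl
  ⟨⟩-zero ((a , γ) ∷ f) = trans (+-cong (zeroʳ a) (⟨⟩-zero f)) (+-identityˡ 0#)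

  ⟨⟩-+ : ∀ f φ ψ → ⟨ f , (λ γ → φ γ + ψ γ) ⟩ ≈ ⟨ f , φ ⟩ + ⟨ f , ψ ⟩
  ⟨⟩-+ []            φ ψ = sym (+-identityˡ 0#)
  ⟨⟩-+ ((a , γ) ∷ f) φ ψ =
    trans (+-cong (distribˡ a _ _) (⟨⟩-+ f φ ψ)) (+Semi.interchange _ _ _ _)

  ⟨⟩-* : ∀ f a φ → ⟨ f , (λ γ → a * φ γ) ⟩ ≈ a * ⟨ f , φ ⟩
  ⟨⟩-* []            a φ = sym (zeroʳ a)
  ⟨⟩-* ((b , γ) ∷ f) a φ = trans (+-cong ba≈ab (⟨⟩-* f a φ)) (sym (distribˡ a _ _))
    where
    ba≈ab = trans (sym (*-assoc b a _)) (trans (*-congʳ (*-comm b a)) (*-assoc a b _))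

  -- Interchange of two finite sums, from which commutativity of `*ᴾ` follows.
  ⟨⟩-comm : ∀ f g (χ : Exponents → Exponents → Carrier) →
            ⟨ f , (λ γ → ⟨ g , χ γ ⟩) ⟩ ≈ ⟨ g , (λ δ → ⟨ f , (λ γ → χ γ δ) ⟩) ⟩
  ⟨⟩-comm []            g χ = sym (⟨⟩-zero g)
  ⟨⟩-comm ((a , γ) ∷ f) g χ = begin
    a * ⟨ g , χ γ ⟩ + ⟨ f , (λ γ → ⟨ g , χ γ ⟩) ⟩
      ≈⟨ +-cong (sym (⟨⟩-* g a (χ γ))) (⟨⟩-comm f g χ) ⟩
    ⟨ g , (λ δ → a * χ γ δ) ⟩ + ⟨ g , (λ δ → ⟨ f , (λ γ → χ γ δ) ⟩) ⟩
      ≈⟨ ⟨⟩-+ g _ _ ⟨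
    ⟨ g , (λ δ → ⟨ (a , γ) ∷ f , (λ γ → χ γ δ) ⟩) ⟩ ∎

  monomial* : Carrier × Exponents → Poly → Poly
  monomial* (a , γ) = List.map λ (b , δ) → a * b , γ ⊕ δ

  ⟨⟩-monomial* : ∀ a γ g φ → ⟨ monomial* (a , γ) g , φ ⟩ ≈ a * ⟨ g , (λ δ → φ (γ ⊕ δ)) ⟩
  ⟨⟩-monomial* a γ []            φ = sym (zeroʳ a)
  ⟨⟩-monomial* a γ ((b , δ) ∷ g) φ =
    trans (+-cong (*-assoc a b _) (⟨⟩-monomial* a γ g φ)) (sym (distribˡ a _ _))

  -- Turns the multiplicative laws below into statements about iterated sums.
  ⟨⟩-*ᴾ : ∀ f g φ → ⟨ f *ᴾ g , φ ⟩ ≈ ⟨ f , (λ γ → ⟨ g , (λ δ → φ (γ ⊕ δ)) ⟩) ⟩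
  ⟨⟩-*ᴾ []            g φ = refl
  ⟨⟩-*ᴾ ((a , γ) ∷ f) g φ =
    trans (⟨⟩-++ (monomial* (a , γ) g) (f *ᴾ g) φ) (+-cong (⟨⟩-monomial* a γ g φ) (⟨⟩-*ᴾ f g φ))

  -- Two formal sums denote the same polynomial when all linear functionals
  -- agree on them. In this form, multiplication is visibly well defined.
  infix 4 _≋_
  record _≋_ (f g : Poly) : Set (c ⊔ ℓ) where
    constructor pointwise
    field at : ∀ φ → ⟨ f , φ ⟩ ≈ ⟨ g , φ ⟩
  open _≋_ public

  -- The functional is the indicator function of `γ`.
  coeff-⟨⟩ : ∀ γ → Σ[ φ ∈ (Exponents → Carrier) ] (∀ f → coeff f γ ≈ ⟨ f , φ ⟩)
  coeff-⟨⟩ γ = φ , eq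
    where
    φ : Exponents → Carrier
    φ δ with δ ≟ᴱ γ
    ... | yes _ = 1#
    ... | no  _ = 0#
    eq : ∀ f → coeff f γ ≈ ⟨ f , φ ⟩
    eq [] = refl
    eq ((a , δ) ∷ f) with δ ≟ᴱ γ
    ... | yes _ = +-cong (sym (*-identityʳ a)) (eq f)
    ... | no  _ = trans (eq f) (trans (sym (+-identityˡ _)) (+-congʳ (sym (zeroʳ a))))

  ≋⇒coeff-≈ : ∀ {f g} → f ≋ g → ∀ γ → coeff f γ ≈ coeff g γ
  ≋⇒coeff-≈ {f} {g} f≋g γ =
    let φ , coeff≈ = coeff-⟨⟩ γ
    in trans (coeff≈ f) (trans (at f≋g φ) (sym (coeff≈ g)))

  *ᴾ-cong : ∀ {f f′ g g′} → f ≋ f′ → g ≋ g′ → f *ᴾ g ≋ f′ *ᴾ g′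
  *ᴾ-cong {f} {f′} {g} {g′} f≋f′ g≋g′ .at φ = begin
    ⟨ f *ᴾ g , φ ⟩                                  ≈⟨ ⟨⟩-*ᴾ f g φ ⟩
    ⟨ f , (λ γ → ⟨ g , (λ δ → φ (γ ⊕ δ)) ⟩) ⟩       ≈⟨ ⟨⟩-cong f (λ γ → at g≋g′ _) ⟩
    ⟨ f , (λ γ → ⟨ g′ , (λ δ → φ (γ ⊕ δ)) ⟩) ⟩      ≈⟨ at f≋f′ _ ⟩
    ⟨ f′ , (λ γ → ⟨ g′ , (λ δ → φ (γ ⊕ δ)) ⟩) ⟩     ≈⟨ ⟨⟩-*ᴾ f′ g′ φ ⟨
    ⟨ f′ *ᴾ g′ , φ ⟩                                ∎

  *ᴾ-comm : ∀ f g → f *ᴾ g ≋ g *ᴾ f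
  *ᴾ-comm f g .at φ = begin
    ⟨ f *ᴾ g , φ ⟩                                  ≈⟨ ⟨⟩-*ᴾ f g φ ⟩
    ⟨ f , (λ γ → ⟨ g , (λ δ → φ (γ ⊕ δ)) ⟩) ⟩       ≈⟨ ⟨⟩-comm f g _ ⟩
    ⟨ g , (λ δ → ⟨ f , (λ γ → φ (γ ⊕ δ)) ⟩) ⟩
      ≈⟨ ⟨⟩-cong g (λ δ → ⟨⟩-cong f (λ γ → reflexive (≡.cong φ (⊕-comm γ δ)))) ⟩
    ⟨ g , (λ δ → ⟨ f , (λ γ → φ (δ ⊕ γ)) ⟩) ⟩       ≈⟨ ⟨⟩-*ᴾ g f φ ⟨
    ⟨ g *ᴾ f , φ ⟩                                  ∎

  *ᴾ-assoc : ∀ f g h → (f *ᴾ g) *ᴾ h ≋ f *ᴾ (g *ᴾ h)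
  *ᴾ-assoc f g h .at φ = begin
    ⟨ (f *ᴾ g) *ᴾ h , φ ⟩
      ≈⟨ ⟨⟩-*ᴾ (f *ᴾ g) h φ ⟩
    ⟨ f *ᴾ g , (λ γ → ⟨ h , (λ ε → φ (γ ⊕ ε)) ⟩) ⟩
      ≈⟨ ⟨⟩-*ᴾ f g _ ⟩
    ⟨ f , (λ γ → ⟨ g , (λ δ → ⟨ h , (λ ε → φ ((γ ⊕ δ) ⊕ ε)) ⟩) ⟩) ⟩
      ≈⟨ ⟨⟩-cong f (λ γ → ⟨⟩-cong g λ δ → ⟨⟩-cong h λ ε → reflexive (≡.cong φ (⊕-assoc γ δ ε))) ⟩
    ⟨ f , (λ γ → ⟨ g , (λ δ → ⟨ h , (λ ε → φ (γ ⊕ (δ ⊕ ε))) ⟩) ⟩) ⟩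
      ≈⟨ ⟨⟩-cong f (λ γ → ⟨⟩-*ᴾ g h (λ δ → φ (γ ⊕ δ))) ⟨
    ⟨ f , (λ γ → ⟨ g *ᴾ h , (λ δ → φ (γ ⊕ δ)) ⟩) ⟩
      ≈⟨ ⟨⟩-*ᴾ f (g *ᴾ h) φ ⟨
    ⟨ f *ᴾ (g *ᴾ h) , φ ⟩
      ∎

  *ᴾ-identityˡ : ∀ f → 1ᴾ *ᴾ f ≋ f
  *ᴾ-identityˡ f .at φ = begin
    ⟨ 1ᴾ *ᴾ f , φ ⟩                                     ≈⟨ ⟨⟩-*ᴾ 1ᴾ f φ ⟩
    1# * ⟨ f , (λ γ → φ (replicate k 0 ⊕ γ)) ⟩ + 0#     ≈⟨ +-identityʳ _ ⟩
    1# * ⟨ f , (λ γ → φ (replicate k 0 ⊕ γ)) ⟩          ≈⟨ *-identityˡ _ ⟩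
    ⟨ f , (λ γ → φ (replicate k 0 ⊕ γ)) ⟩
      ≈⟨ ⟨⟩-cong f (λ γ → reflexive (≡.cong φ (⊕-identityˡ γ))) ⟩
    ⟨ f , φ ⟩                                           ∎

  polynomialSemiring : CommutativeSemiring c (c ⊔ ℓ)
  polynomialSemiring = record
    { Carrier = Poly
    ; _≈_ = _≋_
    ; _+_ = _++_
    ; _*_ = _*ᴾ_
    ; 0# = []
    ; 1# = 1ᴾ
    ; isCommutativeSemiring = isCommutativeSemiringˡ record
      { +-isCommutativeMonoid = isCommutativeMonoidˡ record
        { isSemigroup = record
          { isMagma = record { isEquivalence = ≋-isEquivalence ; ∙-cong = ++-cong }
          ; assoc = λ f g h → ≡⇒≋ (ListP.++-assoc f g h) }
        ; identityˡ = λ f → ≋-refl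
        ; comm = ++-comm }
      ; *-isCommutativeMonoid = isCommutativeMonoidˡ record
        { isSemigroup = record
          { isMagma = record { isEquivalence = ≋-isEquivalence ; ∙-cong = *ᴾ-cong }
          ; assoc = *ᴾ-assoc }
        ; identityˡ = *ᴾ-identityˡ
        ; comm = *ᴾ-comm }
      ; distribʳ = λ f g h → ≡⇒≋ (ListP.cartesianProductWith-distribʳ-++ _ g h f)
      ; zeroˡ = λ f → ≋-refl
      }
    }
    where
    open import Algebra.Structures.Biased _≋_
      using (isCommutativeSemiringˡ; isCommutativeMonoidˡ)
    open import Relation.Binary.Structures using (IsEquivalence)
    ≋-refl : ∀ {f} → f ≋ f
    ≋-refl .at φ = refl
    ≡⇒≋ : ∀ {f g} → f ≡ g → f ≋ g
    ≡⇒≋ ≡.refl = ≋-refl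
    ≋-isEquivalence : IsEquivalence _≋_
    ≋-isEquivalence = record
      { refl  = ≋-refl
      ; sym   = λ f≋g → pointwise λ φ → sym (at f≋g φ)
      ; trans = λ f≋g g≋h → pointwise λ φ → trans (at f≋g φ) (at g≋h φ)
      }
    ++-cong : ∀ {f f′ g g′} → f ≋ f′ → g ≋ g′ → f ++ g ≋ f′ ++ g′
    ++-cong {f} {f′} {g} {g′} f≋f′ g≋g′ .at φ =
      trans (⟨⟩-++ f g φ) (trans (+-cong (at f≋f′ φ) (at g≋g′ φ)) (sym (⟨⟩-++ f′ g′ φ)))
    ++-comm : ∀ f g → f ++ g ≋ g ++ f
    ++-comm f g .at φ = trans (⟨⟩-++ f g φ) (trans (+-comm _ _) (sym (⟨⟩-++ g f φ)))

  private
    module P where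
      open CommutativeSemiring polynomialSemiring public
      open Exp polynomialSemiring public
      open Mult (CommutativeSemiring.semiring polynomialSemiring) public
    module Field× = Mult semiring

  ^ᴾ-≡ : ∀ f n → f ^ᴾ n ≡ f P.^ n
  ^ᴾ-≡ f zero    = ≡.refl
  ^ᴾ-≡ f (suc n) = ≡.cong (f *ᴾ_) (^ᴾ-≡ f n)

  -- As a list, the multiple is `n` copies of the term 1 and does not collapse; the characteristic
  -- of the field becomes visible only under functionals.
  ⟨⟩-×1ᴾ : ∀ n φ → ⟨ n P.× 1ᴾ , φ ⟩ ≈ (n Field×.× 1#) * φ (replicate k 0)
  ⟨⟩-×1ᴾ zero    φ = sym (zeroˡ _)
  ⟨⟩-×1ᴾ (suc n) φ = trans (+-congˡ (⟨⟩-×1ᴾ n φ)) (sym (distribʳ _ _ _))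

  ×1ᴾ≋0 : ∀ {n} → n Field×.× 1# ≈ 0# → n P.× 1ᴾ ≋ []
  ×1ᴾ≋0 {n} n×1≈0 .at φ = trans (⟨⟩-×1ᴾ n φ) (trans (*-congʳ n×1≈0) (zeroˡ _))

  substPower : ℕ → Poly → Poly
  substPower n = List.map λ (a , γ) → a , scale n γ

  monomial-^ : ∀ a γ n → ((a , γ) ∷ []) P.^ n ≡ (a ^ n , scale n γ) ∷ []
  monomial-^ a γ zero    = ≡.cong (λ δ → (1# , δ) ∷ []) (≡.sym (scale-zero γ))
  monomial-^ a γ (suc n) rewrite monomial-^ a γ n =
    ≡.cong (λ δ → (a * a ^ n , δ) ∷ []) (≡.sym (scale-suc n γ))

  -- Additivity of the q-th power splits off one term at a time, and a single term satisfies (a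
  -- x^γ)^q = a^q x^(qγ) with a^q = a by `fermat`.
  frobenius : IsPrimePower q → ∀ f → f P.^ q ≋ substPower q f
  frobenius (p , e , p-prime , _ , q≡pᵉ) = go
    where
    homo : ∀ f g → (f ++ g) P.^ q ≋ (f P.^ q) ++ (g P.^ q)
    homo f g = ≡.subst (λ n → (f ++ g) P.^ n ≋ (f P.^ n) ++ (g P.^ n)) (≡.sym q≡pᵉ)
      (Frobenius.^pᵉ-homo-+ polynomialSemiring p-prime (×1ᴾ≋0 {p} char-p) e f g)
      where
      char-p = pᵉ·1≈0⇒p·1≈0 p e (≡.subst (λ n → n Field×.× 1# ≈ 0#) q≡pᵉ q·1≈0)
    []^ : ∀ n → Fin n → [] P.^ n ≋ []
    []^ (suc n) _ = P.refl
    go : ∀ f → f P.^ q ≋ substPower q f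
    go []            = []^ q (index 0#)
    go ((a , γ) ∷ f) = P.trans (homo ((a , γ) ∷ []) f) (P.+-cong
      (P.trans (P.reflexive (monomial-^ a γ q)) (pointwise λ φ → +-congʳ (*-congʳ (fermat a)))) (go f))

  substPower-*ᴾ : ∀ n f g → substPower n (f *ᴾ g) ≡ substPower n f *ᴾ substPower n g
  substPower-*ᴾ n []            g = ≡.refl
  substPower-*ᴾ n ((a , γ) ∷ f) g =
    ≡.trans (ListP.map-++ _ (monomial* (a , γ) g) (f *ᴾ g))
      (≡.cong₂ _++_ (monomial g) (substPower-*ᴾ n f g))
    where
    monomial : ∀ g → substPower n (monomial* (a , γ) g) ≡ monomial* (a , scale n γ) (substPower n g)
    monomial []            = ≡.refl
    monomial ((b , δ) ∷ g) = ≡.cong₂ (λ ε → (a * b , ε) ∷_) (scale-⊕ n γ δ) (monomial g)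

  substPower-^ : ∀ n f m → substPower n (f P.^ m) ≡ substPower n f P.^ m
  substPower-^ n f zero    = ≡.cong (λ δ → (1# , δ) ∷ []) (scale-replicate-0 k n)
  substPower-^ n f (suc m) =
    ≡.trans (substPower-*ᴾ n f (f P.^ m)) (≡.cong (substPower n f *ᴾ_) (substPower-^ n f m))

  ^ᴾ-+-* : IsPrimePower q → ∀ f a m g →
           f ^ᴾ (a ℕ.+ m ℕ.* q) *ᴾ g ≋ substPower q (f ^ᴾ m) *ᴾ (f ^ᴾ a *ᴾ g)
  ^ᴾ-+-* q-pp f a m g rewrite ^ᴾ-≡ f (a ℕ.+ m ℕ.* q) | ^ᴾ-≡ f m | ^ᴾ-≡ f a =
    P.trans (P.*-congʳ step) (P.*-assoc (substPower q (f P.^ m)) (f P.^ a) g)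
    where
    module R = SetoidReasoning P.setoid
    step : f P.^ (a ℕ.+ m ℕ.* q) ≋ substPower q (f P.^ m) *ᴾ (f P.^ a)
    step = R.begin
      f P.^ (a ℕ.+ m ℕ.* q)                R.≈⟨ P.^-homo-* f a (m ℕ.* q) ⟩
      (f P.^ a) *ᴾ (f P.^ (m ℕ.* q))       R.≈⟨ P.*-comm (f P.^ a) (f P.^ (m ℕ.* q)) ⟩
      (f P.^ (m ℕ.* q)) *ᴾ (f P.^ a)       R.≈⟨ P.*-congʳ (P.^-congʳ f (ℕP.*-comm m q)) ⟩
      (f P.^ (q ℕ.* m)) *ᴾ (f P.^ a)       R.≈⟨ P.*-congʳ (P.^-assocʳ f q m) ⟨
      ((f P.^ q) P.^ m) *ᴾ (f P.^ a)       R.≈⟨ P.*-congʳ (P.^-congˡ m (frobenius q-pp f)) ⟩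
      (substPower q f P.^ m) *ᴾ (f P.^ a)  R.≡⟨ ≡.cong (_*ᴾ (f P.^ a)) (substPower-^ q f m) ⟨
      substPower q (f P.^ m) *ᴾ (f P.^ a)  R.∎

  coeff-++ : ∀ f g γ → coeff (f ++ g) γ ≈ coeff f γ + coeff g γ
  coeff-++ []            g γ = sym (+-identityˡ _)
  coeff-++ ((a , δ) ∷ f) g γ with δ ≟ᴱ γ
  ... | yes _ = trans (+-congˡ (coeff-++ f g γ)) (sym (+-assoc _ _ _))
  ... | no  _ = coeff-++ f g γ

  coeff-monomial*-⊕ : ∀ a ε g γ → coeff (monomial* (a , ε) g) (ε ⊕ γ) ≈ a * coeff g γ
  coeff-monomial*-⊕ a ε []            γ = sym (zeroʳ a)
  coeff-monomial*-⊕ a ε ((b , δ) ∷ g) γ with (ε ⊕ δ) ≟ᴱ (ε ⊕ γ) | δ ≟ᴱ γ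
  ... | yes _  | yes _   = trans (+-congˡ (coeff-monomial*-⊕ a ε g γ)) (sym (distribˡ a _ _))
  ... | yes eq | no δ≢γ  = ⊥-elim (δ≢γ (⊕-cancelˡ ε eq))
  ... | no neq | yes δ≡γ = ⊥-elim (neq (≡.cong (ε ⊕_) δ≡γ))
  ... | no _   | no _    = coeff-monomial*-⊕ a ε g γ

  coeff-monomial*-∄ : ∀ a ε g γ → ¬ (∃ λ δ → γ ≡ ε ⊕ δ) → coeff (monomial* (a , ε) g) γ ≈ 0#
  coeff-monomial*-∄ a ε []            γ ∄ = refl
  coeff-monomial*-∄ a ε ((b , δ) ∷ g) γ ∄ with (ε ⊕ δ) ≟ᴱ γ
  ... | yes eq = ⊥-elim (∄ (δ , ≡.sym eq))
  ... | no  _  = coeff-monomial*-∄ a ε g γ ∄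

  -- With `s = scale q` and `ι = section j`: if `h` is the section of `g` at δ, then `f h` is the
  -- section of `f(x^q) g` at δ. Term by term, the first condition on `ι` matches the coefficients
  -- at multiples of x^ε; the second says that divisibility by x^(s ε) is not created by `ι`, so the
  -- vanishing coefficients match too.
  coeff-*ᴾ-transfer : (s ι : Exponents → Exponents) →
    (∀ ε γ → ι (ε ⊕ γ) ≡ s ε ⊕ ι γ) →
    (∀ ε γ η → ι γ ≡ s ε ⊕ η → ∃ λ δ → γ ≡ ε ⊕ δ) →
    ∀ g h → (∀ γ → coeff h γ ≈ coeff g (ι γ)) →
    ∀ f γ → coeff (f *ᴾ h) γ ≈ coeff (List.map (λ (a , ε) → a , s ε) f *ᴾ g) (ι γ)
  coeff-*ᴾ-transfer s ι ι-⊕ ι-∣ g h h≈g = go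
    where
    term : ∀ a ε γ → coeff (monomial* (a , ε) h) γ ≈ coeff (monomial* (a , s ε) g) (ι γ)
    term a ε γ with ∃-⊕? ε γ
    ... | yes (δ , ≡.refl) = begin
      coeff (monomial* (a , ε) h) (ε ⊕ δ)         ≈⟨ coeff-monomial*-⊕ a ε h δ ⟩
      a * coeff h δ                               ≈⟨ *-congˡ (h≈g δ) ⟩
      a * coeff g (ι δ)                           ≈⟨ coeff-monomial*-⊕ a (s ε) g (ι δ) ⟨
      coeff (monomial* (a , s ε) g) (s ε ⊕ ι δ)   ≡⟨ ≡.cong (coeff (monomial* (a , s ε) g)) (ι-⊕ ε δ) ⟨
      coeff (monomial* (a , s ε) g) (ι (ε ⊕ δ))   ∎
    ... | no ∄ = trans (coeff-monomial*-∄ a ε h γ ∄)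
      (sym (coeff-monomial*-∄ a (s ε) g (ι γ) λ (η , eq) → ∄ (ι-∣ ε γ η eq)))
    go : ∀ f γ → coeff (f *ᴾ h) γ ≈ coeff (List.map (λ (a , ε) → a , s ε) f *ᴾ g) (ι γ)
    go []            γ = refl
    go ((a , ε) ∷ f) γ = trans (coeff-++ (monomial* (a , ε) h) (f *ᴾ h) γ)
      (trans (+-cong (term a ε γ) (go f γ)) (sym (coeff-++ (monomial* (a , s ε) g) _ (ι γ))))

  -- The case where `s` and `ι` are identities; `*ᴾ-cong` does not serve, as it asks for `≋`.
  coeff-*ᴾ-congʳ : ∀ g h → (∀ γ → coeff h γ ≈ coeff g γ) →
                   ∀ f γ → coeff (f *ᴾ h) γ ≈ coeff (f *ᴾ g) γ
  coeff-*ᴾ-congʳ g h h≈g f γ = trans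
    (coeff-*ᴾ-transfer (λ ε → ε) (λ γ → γ) (λ _ _ → ≡.refl) (λ _ _ η eq → η , eq) g h h≈g f γ)
    (reflexive (≡.cong (λ f → coeff (f *ᴾ g) γ) (ListP.map-id f)))

-- Boxes of exponents and division of exponents by q with remainder.

Unique-set⇒length-≡ : ∀ {a} {A : Set a} {xs ys : List A} → Unique xs → Unique ys →
                       (∀ {x} → x ∈ xs ⇔ x ∈ ys) → length xs ≡ length ys
Unique-set⇒length-≡ xs! ys! xs⇔ys = ↭-length (∼bag⇒↭ (unique∧set⇒bag xs! ys! xs⇔ys))

Vec-ext : ∀ {k} {γ δ : Vec ℕ k} → (∀ i → lookup γ i ≡ lookup δ i) → γ ≡ δ
Vec-ext {γ = γ} {δ} eq =
  ≡.trans (≡.sym (VecP.tabulate∘lookup γ)) (≡.trans (VecP.tabulate-cong eq) (VecP.tabulate∘lookup δ))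

≤⇒∃-⊕ : ∀ {k} {ε γ : Vec ℕ k} → (∀ i → lookup ε i ≤ lookup γ i) → ∃ λ δ → γ ≡ ε ⊕ δ
≤⇒∃-⊕ {ε = ε} {γ} ε≤γ = zipWith ℕ._∸_ γ ε , Vec-ext λ i → begin
  lookup γ i                                     ≡⟨ ℕP.m+[n∸m]≡n (ε≤γ i) ⟨
  lookup ε i ℕ.+ (lookup γ i ℕ.∸ lookup ε i)
    ≡⟨ ≡.cong (lookup ε i ℕ.+_) (VecP.lookup-zipWith ℕ._∸_ i γ ε) ⟨
  lookup ε i ℕ.+ lookup (zipWith ℕ._∸_ γ ε) i    ≡⟨ VecP.lookup-zipWith ℕ._+_ i ε _ ⟨
  lookup (ε ⊕ zipWith ℕ._∸_ γ ε) i               ∎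
  where open ≡.≡-Reasoning

funToFin-cong : ∀ {m n} {f g : Fin m → Fin n} → (∀ i → f i ≡ g i) → funToFin f ≡ funToFin g
funToFin-cong {zero}  f≗g = ≡.refl
funToFin-cong {suc m} f≗g = ≡.cong₂ Fin.combine (f≗g Fin.zero) (funToFin-cong (f≗g ∘ Fin.suc))

module Box (b k : ℕ) where

  -- Used at two sizes: `b = q` lists the residues δ, and `b = suc E` lists the exponents at which a
  -- state stores a coefficient.
  box : Fin (b ℕ.^ k) → Vec ℕ k
  box j = Vec.tabulate (toℕ ∘ finToFun {b} {k} j)

  lookup-box : ∀ (j : Fin (b ℕ.^ k)) i → lookup (box j) i ≡ toℕ (finToFun {b} {k} j i)
  lookup-box j i = VecP.lookup∘tabulate (toℕ ∘ finToFun {b} {k} j) i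

  box-< : ∀ (j : Fin (b ℕ.^ k)) i → lookup (box j) i < b
  box-< j i = ≡.subst (_< b) (≡.sym (lookup-box j i)) (FinP.toℕ<n _)

  box-injective : ∀ {i j : Fin (b ℕ.^ k)} → box i ≡ box j → i ≡ j
  box-injective {i} {j} eq = begin
    i                              ≡⟨ FinP.funToFin-finToFin {k} i ⟨
    funToFin (finToFun {b} {k} i)  ≡⟨ funToFin-cong {k} (λ l → FinP.toℕ-injective (lookup-≡ l)) ⟩
    funToFin (finToFun {b} {k} j)  ≡⟨ FinP.funToFin-finToFin {k} j ⟩
    j                              ∎
    where
    open ≡.≡-Reasoning
    lookup-≡ : ∀ l → toℕ (finToFun {b} {k} i l) ≡ toℕ (finToFun {b} {k} j l)
    lookup-≡ l = ≡.trans (≡.sym (lookup-box i l)) (≡.trans (≡.cong (λ γ → lookup γ l) eq) (lookup-box j l))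

  box-surjective : ∀ (γ : Vec ℕ k) → (∀ i → lookup γ i < b) → ∃ λ j → box j ≡ γ
  box-surjective γ γ<b = funToFin {k} (λ i → fromℕ< (γ<b i)) , Vec-ext λ i →
    ≡.trans (lookup-box _ i)
      (≡.trans (≡.cong toℕ (FinP.finToFun-funToFin (λ i → fromℕ< (γ<b i)) i)) (FinP.toℕ-fromℕ< (γ<b i)))

r+q*m-injective : ∀ {q} {{_ : NonZero q}} {r s m n} → r < q → s < q →
                   r ℕ.+ q ℕ.* m ≡ s ℕ.+ q ℕ.* n → r ≡ s × m ≡ n
r+q*m-injective {q} {r} {s} {m} {n} r<q s<q eq = r≡s ,
  ℕP.*-cancelˡ-≡ m n q (ℕP.+-cancelˡ-≡ s _ _ (≡.trans (≡.cong (ℕ._+ q ℕ.* m) (≡.sym r≡s)) eq))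
  where
  residue : ∀ {r} m → r < q → r ≡ (r ℕ.+ q ℕ.* m) % q
  residue {r} m r<q = ≡.sym (≡.trans (≡.cong (λ n → (r ℕ.+ n) % q) (ℕP.*-comm q m))
    (≡.trans ([m+kn]%n≡m%n r m q) (m<n⇒m%n≡m r<q)))
  r≡s = ≡.trans (residue m r<q) (≡.trans (≡.cong (_% q) eq) (≡.sym (residue n s<q)))

module Sections (q k : ℕ) {{_ : NonZero q}} where

  open Box q k

  -- With δ = `box j`, the coefficient of h_δ at `γ` is that of the original polynomial at
  -- `section j γ`. As `j` varies, the images partition all exponent vectors.
  section : Fin (q ℕ.^ k) → Vec ℕ k → Vec ℕ k
  section j γ = box j ⊕ scale q γ

  lookup-section : ∀ (j : Fin (q ℕ.^ k)) γ i →
                   lookup (section j γ) i ≡ lookup (box j) i ℕ.+ q ℕ.* lookup γ i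
  lookup-section j γ i = ≡.trans (VecP.lookup-zipWith ℕ._+_ i (box j) (scale q γ))
    (≡.cong (lookup (box j) i ℕ.+_) (VecP.lookup-map i (q ℕ.*_) γ))

  section-⊕ : ∀ (j : Fin (q ℕ.^ k)) ε γ → section j (ε ⊕ γ) ≡ scale q ε ⊕ section j γ
  section-⊕ j ε γ = begin
    box j ⊕ scale q (ε ⊕ γ)             ≡⟨ ≡.cong (box j ⊕_) (scale-⊕ q ε γ) ⟩
    box j ⊕ (scale q ε ⊕ scale q γ)     ≡⟨ ⊕-assoc _ _ _ ⟨
    (box j ⊕ scale q ε) ⊕ scale q γ     ≡⟨ ≡.cong (_⊕ scale q γ) (⊕-comm _ _) ⟩
    (scale q ε ⊕ box j) ⊕ scale q γ     ≡⟨ ⊕-assoc _ _ _ ⟩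
    scale q ε ⊕ (box j ⊕ scale q γ)     ∎
    where open ≡.≡-Reasoning

  -- The residue is too small to contribute: q ε_i ≤ δ_i + q γ_i < q (γ_i + 1) forces ε_i ≤ γ_i.
  section-∣ : ∀ (j : Fin (q ℕ.^ k)) ε γ η → section j γ ≡ scale q ε ⊕ η → ∃ λ δ → γ ≡ ε ⊕ δ
  section-∣ j ε γ η eq = ≤⇒∃-⊕ λ i →
    ℕP.≤-pred (ℕP.*-cancelˡ-< q (lookup ε i) (suc (lookup γ i)) (bound i))
    where
    open ℕP.≤-Reasoning
    bound : ∀ i → q ℕ.* lookup ε i < q ℕ.* suc (lookup γ i)
    bound i = begin-strict
      q ℕ.* lookup ε i                               ≤⟨ ℕP.m≤m+n _ (lookup η i) ⟩
      q ℕ.* lookup ε i ℕ.+ lookup η i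
        ≡⟨ ≡.cong (ℕ._+ lookup η i) (VecP.lookup-map i (q ℕ.*_) ε) ⟨
      lookup (scale q ε) i ℕ.+ lookup η i            ≡⟨ VecP.lookup-zipWith ℕ._+_ i (scale q ε) η ⟨
      lookup (scale q ε ⊕ η) i                       ≡⟨ ≡.cong (λ γ → lookup γ i) eq ⟨
      lookup (section j γ) i                         ≡⟨ lookup-section j γ i ⟩
      lookup (box j) i ℕ.+ q ℕ.* lookup γ i          <⟨ ℕP.+-monoˡ-< _ (box-< j i) ⟩
      q ℕ.+ q ℕ.* lookup γ i                         ≡⟨ ℕP.*-suc q (lookup γ i) ⟨
      q ℕ.* suc (lookup γ i)                         ∎

  section-injective : ∀ {i j : Fin (q ℕ.^ k)} {γ δ} → section i γ ≡ section j δ → i ≡ j × γ ≡ δ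
  section-injective {i = i} {j} {γ} {δ} eq =
    box-injective (Vec-ext (proj₁ ∘ components)) , Vec-ext (proj₂ ∘ components)
    where
    components : ∀ l → lookup (box i) l ≡ lookup (box j) l × lookup γ l ≡ lookup δ l
    components l = r+q*m-injective (box-< i l) (box-< j l)
      (≡.trans (≡.sym (lookup-section i γ l))
        (≡.trans (≡.cong (λ γ → lookup γ l) eq) (lookup-section j δ l)))

  section-surjective : ∀ (η : Vec ℕ k) → ∃ λ j → ∃ λ γ → η ≡ section j γ
  section-surjective η = j , Vec.map (_/ q) η , Vec-ext λ i → begin
    lookup η i
      ≡⟨ m≡m%n+[m/n]*n (lookup η i) q ⟩
    lookup η i % q ℕ.+ lookup η i / q ℕ.* q
      ≡⟨ ≡.cong₂ ℕ._+_ (lookup-% i) (ℕP.*-comm q (lookup η i / q)) ⟨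
    lookup (box j) i ℕ.+ q ℕ.* (lookup η i / q)
      ≡⟨ ≡.cong (λ n → lookup (box j) i ℕ.+ q ℕ.* n) (VecP.lookup-map i (_/ q) η) ⟨
    lookup (box j) i ℕ.+ q ℕ.* lookup (Vec.map (_/ q) η) i
      ≡⟨ lookup-section j _ i ⟨
    lookup (section j (Vec.map (_/ q) η)) i
      ∎
    where
    open ≡.≡-Reasoning
    box-η% : ∃ λ j → box j ≡ Vec.map (_% q) η
    box-η% = box-surjective _ λ i → ≡.subst (_< q) (≡.sym (VecP.lookup-map i (_% q) η)) (m%n<n _ q)
    j = proj₁ box-η%
    lookup-% : ∀ i → lookup (box j) i ≡ lookup η i % q
    lookup-% i = ≡.trans (≡.cong (λ γ → lookup γ i) (proj₂ box-η%)) (VecP.lookup-map i (_% q) η)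

-- Counting coefficients section by section.

module Counting {c ℓ : Level} {q : ℕ} (F : FiniteField c ℓ q) (k : ℕ) where
  open FiniteField F hiding (zero)
  open Polynomials F k
  open FieldProperties F
  instance
    q≢0 : NonZero q
    q≢0 = FinP.nonZeroIndex (index 0#)

  open Box q k public
  open Sections q k public

  module _ {α} (α≉0 : α ≉ 0#) where

    private
      ∈⇔coeff : ∀ f γ → γ ∈ exponentsWith α f ⇔ coeff f γ ≈ α
      ∈⇔coeff f γ = ∈-exponentsWith α≉0 f γ

    count-cong : ∀ f g → (∀ γ → coeff f γ ≈ coeff g γ) →
                 length (exponentsWith α f) ≡ length (exponentsWith α g)
    count-cong f g f≈g =
      Unique-set⇒length-≡ (exponentsWith-unique α f) (exponentsWith-unique α g) λ {γ} → mk⇔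
        (λ γ∈f → from (∈⇔coeff g γ) (trans (sym (f≈g γ)) (to (∈⇔coeff f γ) γ∈f)))
        (λ γ∈g → from (∈⇔coeff f γ) (trans (f≈g γ) (to (∈⇔coeff g γ) γ∈g)))
      where open Equivalence

    -- Both lists are free of duplicates and have the same members: every section map is injective,
    -- different ones have disjoint images, and together they reach every exponent.
    count-sections : ∀ f (h : Fin (q ℕ.^ k) → Poly) →
      (∀ j γ → coeff (h j) γ ≈ coeff f (section j γ)) →
      length (exponentsWith α f) ≡
        length (concat (tabulate λ j → List.map (section j) (exponentsWith α (h j))))
    count-sections f h h≈f = Unique-set⇒length-≡ (exponentsWith-unique α f)
      (Unique.concat⁺
        (AllP.tabulate⁺ λ j →
          Unique.map⁺ (proj₂ ∘ section-injective) (exponentsWith-unique α (h j)))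
        (AllPairsP.tabulate⁺ λ {i} {j} i≢j (η∈i , η∈j) →
          let γ , _ , η≡ = ∈-map⁻ (section i) η∈i
              δ , _ , η≡′ = ∈-map⁻ (section j) η∈j
          in i≢j (proj₁ (section-injective (≡.trans (≡.sym η≡) η≡′)))))
      (mk⇔ split join)
      where
      open Equivalence
      pieces : Fin (q ℕ.^ k) → List Exponents
      pieces j = List.map (section j) (exponentsWith α (h j))
      split : ∀ {η} → η ∈ exponentsWith α f → η ∈ concat (tabulate pieces)
      split {η} η∈ with section-surjective η
      ... | j , γ , ≡.refl = ∈-concat⁺′
        (∈-map⁺ (section j) (from (∈⇔coeff (h j) γ) (trans (h≈f j γ) (to (∈⇔coeff f _) η∈))))
        (∈-tabulate⁺ j)
      join : ∀ {η} → η ∈ concat (tabulate pieces) → η ∈ exponentsWith α f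
      join {η} η∈ with ∈-concat⁻′ (tabulate pieces) η∈
      ... | xs , η∈xs , xs∈ with ∈-tabulate⁻ xs∈
      ... | j , ≡.refl with ∈-map⁻ (section j) η∈xs
      ... | γ , γ∈ , ≡.refl = from (∈⇔coeff f _) (trans (sym (h≈f j γ)) (to (∈⇔coeff (h j) γ) γ∈))

-- Linear algebra over the integers.

module ℤ∑ = SemiringSum ℤP.+-*-semiring

+-length-concat : ∀ {a} {A : Set a} {n} (xs : Fin n → List A) →
                  + length (concat (tabulate xs)) ≡ ℤ∑.sum (λ j → + length (xs j))
+-length-concat {n = zero}  xs = ≡.refl
+-length-concat {n = suc n} xs = ≡.trans
  (≡.cong +_ (ListP.length-++ (xs Fin.zero)))
  (≡.trans (ℤP.pos-+ (length (xs Fin.zero)) _)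
    (≡.cong (ℤ._+_ (+ length (xs Fin.zero))) (+-length-concat (xs ∘ Fin.suc))))

basis : ∀ {n} → Fin n → Vector ℤ n
basis Fin.zero    Fin.zero    = ℤ.1ℤ
basis Fin.zero    (Fin.suc j) = ℤ.0ℤ
basis (Fin.suc i) Fin.zero    = ℤ.0ℤ
basis (Fin.suc i) (Fin.suc j) = basis i j

∙ᵥ-basis : ∀ {n} (y : Vector ℤ n) i → y ∙ᵥ basis i ≡ y i
∙ᵥ-basis {suc n} y Fin.zero = begin
  y Fin.zero ℤ.* ℤ.1ℤ ℤ.+ ℤ∑.sum (λ j → y (Fin.suc j) ℤ.* ℤ.0ℤ)
    ≡⟨ ≡.cong₂ ℤ._+_ (ℤP.*-identityʳ (y Fin.zero))
         (≡.trans (ℤ∑.sum-cong-≗ (λ j → ℤP.*-zeroʳ (y (Fin.suc j)))) (ℤ∑.sum-replicate-zero n)) ⟩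
  y Fin.zero ℤ.+ ℤ.0ℤ
    ≡⟨ ℤP.+-identityʳ _ ⟩
  y Fin.zero
    ∎
  where open ≡.≡-Reasoning
∙ᵥ-basis {suc n} y (Fin.suc i) = ≡.trans
  (≡.cong₂ ℤ._+_ (ℤP.*-zeroʳ (y Fin.zero)) (∙ᵥ-basis (y ∘ Fin.suc) i)) (ℤP.+-identityˡ _)

∙ᵥ-sum : ∀ {m n} (y : Vector ℤ n) (x : Fin m → Vector ℤ n) →
         y ∙ᵥ (λ i → ℤ∑.sum (λ j → x j i)) ≡ ℤ∑.sum (λ j → y ∙ᵥ x j)
∙ᵥ-sum y x = ≡.trans
  (ℤ∑.sum-cong-≗ (λ i → ℤ∑.*-distribˡ-sum (y i) (λ j → x j i)))
  (ℤ∑.∑-comm (λ i j → y i ℤ.* x j i))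

-- Associativity y (A w) = (y A) w, which moves a digit matrix from the row of counts to the column
-- vector.
∙ᵥ-*ᵥ : ∀ {m n} (y : Vector ℤ m) (A : Matrix m n) (w : Vector ℤ n) →
        y ∙ᵥ (A *ᵥ w) ≡ (λ j → y ∙ᵥ (λ i → A i j)) ∙ᵥ w
∙ᵥ-*ᵥ y A w = begin
  y ∙ᵥ (λ i → ℤ∑.sum (λ j → A i j ℤ.* w j))     ≡⟨ ∙ᵥ-sum y (λ j i → A i j ℤ.* w j) ⟩
  ℤ∑.sum (λ j → y ∙ᵥ (λ i → A i j ℤ.* w j))     ≡⟨ ℤ∑.sum-cong-≗ column ⟩
  (λ j → y ∙ᵥ (λ i → A i j)) ∙ᵥ w              ∎
  where
  open ≡.≡-Reasoning
  column : ∀ j → y ∙ᵥ (λ i → A i j ℤ.* w j) ≡ (y ∙ᵥ (λ i → A i j)) ℤ.* w j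
  column j = ≡.trans
    (ℤ∑.sum-cong-≗ (λ i → ≡.sym (ℤP.*-assoc (y i) (A i j) (w j))))
    (≡.sym (ℤ∑.*-distribʳ-sum (w j) (λ i → y i ℤ.* A i j)))

-- Polynomials of bounded degree as states, and their transitions.

module States {c ℓ : Level} {q : ℕ} (F : FiniteField c ℓ q) (k E : ℕ) where
  open FiniteField F hiding (zero)
  open Polynomials F k
  open FieldProperties F
  open PolynomialProperties F k
  open Counting F k

  Bounded : ℕ → Exponents → Set
  Bounded n γ = ∀ i → lookup γ i ≤ n

  -- Concerns the listed exponents, even those whose coefficients vanish or cancel, so that it
  -- passes through `*ᴾ` by list operations alone.
  DegreeBound : ℕ → Poly → Set c
  DegreeBound n = All (Bounded n ∘ proj₂)

  coeff-unbounded : ∀ {n f} → DegreeBound n f → ∀ γ → ¬ Bounded n γ → coeff f γ ≈ 0#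
  coeff-unbounded                 []        γ γ≰n = refl
  coeff-unbounded {f = (a , δ) ∷ f} (δ≤n ∷ f≤n) γ γ≰n with δ ≟ᴱ γ
  ... | yes ≡.refl = ⊥-elim (γ≰n δ≤n)
  ... | no  _      = coeff-unbounded f≤n γ γ≰n

  bounded-⊕ : ∀ {m n γ δ} → Bounded m γ → Bounded n δ → Bounded (m ℕ.+ n) (γ ⊕ δ)
  bounded-⊕ {m} {n} {γ} {δ} γ≤m δ≤n i =
    ≡.subst (_≤ m ℕ.+ n) (≡.sym (VecP.lookup-zipWith ℕ._+_ i γ δ)) (ℕP.+-mono-≤ (γ≤m i) (δ≤n i))

  degreeBound-*ᴾ : ∀ {m n f g} → DegreeBound m f → DegreeBound n g → DegreeBound (m ℕ.+ n) (f *ᴾ g)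
  degreeBound-*ᴾ {f = []}          []          g≤n = []
  degreeBound-*ᴾ {f = (a , γ) ∷ f} (γ≤m ∷ f≤m) g≤n = AllP.++⁺
    (AllP.map⁺ (All.map (λ {x} → bounded-⊕ {γ = γ} {proj₂ x} γ≤m) g≤n))
    (degreeBound-*ᴾ f≤m g≤n)

  degreeBound-1ᴾ : ∀ n → DegreeBound n 1ᴾ
  degreeBound-1ᴾ n = (λ i → ≡.subst (_≤ n) (≡.sym (VecP.lookup-replicate i 0)) ℕ.z≤n) ∷ []

  degreeBound-^ᴾ : ∀ {n f} → DegreeBound n f → ∀ m → DegreeBound (m ℕ.* n) (f ^ᴾ m)
  degreeBound-^ᴾ f≤n zero    = degreeBound-1ᴾ 0
  degreeBound-^ᴾ f≤n (suc m) = degreeBound-*ᴾ f≤n (degreeBound-^ᴾ f≤n m)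

  private module States-Box = Box (suc E) k
  open States-Box using () renaming
    (box to exponents; box-< to exponents-<; box-injective to exponents-injective;
     box-surjective to exponents-surjective)

  -- One index per polynomial of degree at most `E` in each variable: `suc E ^ k` exponents with `q`
  -- choices of coefficient at each.
  State : Set
  State = Fin (q ℕ.^ (suc E ℕ.^ k))

  decode : State → Poly
  decode s = tabulate λ j → element (finToFun s j) , exponents j

  -- The input is a coefficient function because an h_δ is given only by its coefficients. Values
  -- outside the box are lost, whence the condition in `coeff-decode-encode`.
  encode : (Exponents → Carrier) → State
  encode w = funToFin λ j → index (w (exponents j))

  degreeBound-decode : ∀ s → DegreeBound E (decode s)
  degreeBound-decode s = AllP.tabulate⁺ λ j i → ℕP.≤-pred (exponents-< j i)

  coeff-tabulate-∉ : ∀ {n} (x : Fin n → Carrier) (e : Fin n → Exponents) {γ} →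
    (∀ j → e j ≢ γ) → coeff (tabulate λ j → x j , e j) γ ≈ 0#
  coeff-tabulate-∉ {zero}  x e     e≢γ = refl
  coeff-tabulate-∉ {suc n} x e {γ} e≢γ with e Fin.zero ≟ᴱ γ
  ... | yes e≡γ = ⊥-elim (e≢γ Fin.zero e≡γ)
  ... | no  _   = coeff-tabulate-∉ (x ∘ Fin.suc) (e ∘ Fin.suc) (e≢γ ∘ Fin.suc)

  coeff-tabulate : ∀ {n} (x : Fin n → Carrier) (e : Fin n → Exponents) →
    (∀ {i j} → e i ≡ e j → i ≡ j) → ∀ i → coeff (tabulate λ j → x j , e j) (e i) ≈ x i
  coeff-tabulate x e e-inj Fin.zero with e Fin.zero ≟ᴱ e Fin.zero
  ... | yes _ = trans
    (+-congˡ (coeff-tabulate-∉ (x ∘ Fin.suc) (e ∘ Fin.suc) λ j eq → FinP.0≢1+n (≡.sym (e-inj eq))))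
    (+-identityʳ _)
  ... | no  e≢e = ⊥-elim (e≢e ≡.refl)
  coeff-tabulate x e e-inj (Fin.suc i) with e Fin.zero ≟ᴱ e (Fin.suc i)
  ... | yes eq = ⊥-elim (FinP.0≢1+n (e-inj eq))
  ... | no  _  =
    coeff-tabulate (x ∘ Fin.suc) (e ∘ Fin.suc) (λ eq → FinP.suc-injective (e-inj eq)) i

  coeff-decode-encode : ∀ w → (∀ γ → ¬ Bounded E γ → w γ ≈ 0#) →
                        ∀ γ → coeff (decode (encode w)) γ ≈ w γ
  coeff-decode-encode w w≈0 γ with FinP.any? (λ j → exponents j ≟ᴱ γ)
  ... | yes (j , ≡.refl) = trans
    (coeff-tabulate _ exponents exponents-injective j)
    (trans (reflexive (≡.cong element (FinP.finToFun-funToFin _ j))) (element-index _))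
  ... | no  ∄j = trans
    (coeff-tabulate-∉ _ exponents (λ j eq → ∄j (j , eq)))
    (sym (w≈0 γ (λ γ≤E → ∄j (exponents-surjective γ (ℕ.s≤s ∘ γ≤E)))))

  module Transitions (f : Poly) (f≤E : DegreeBound E f) where

    -- The code of h_δ for g = `decode s` and δ = `box j`.
    step : Fin q → State → Fin (q ℕ.^ k) → State
    step a s j = encode λ γ → coeff (f ^ᴾ toℕ a *ᴾ decode s) (section j γ)

    -- The bound E reproduces itself: f^a g has degree at most (q-1)E + E = qE
    -- in each variable, hence its sections have degree at most E.
    coeff-step : ∀ a s j γ → coeff (decode (step a s j)) γ ≈
                             coeff (f ^ᴾ toℕ a *ᴾ decode s) (section j γ)
    coeff-step a s j = coeff-decode-encode _ λ γ γ≰E →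
      coeff-unbounded (degreeBound-*ᴾ (degreeBound-^ᴾ f≤E (toℕ a)) (degreeBound-decode s))
        (section j γ) λ sec≤ → γ≰E λ i → ℕP.*-cancelˡ-≤ q (begin
          q ℕ.* lookup γ i                              ≤⟨ ℕP.m≤n+m _ _ ⟩
          lookup (box j) i ℕ.+ q ℕ.* lookup γ i         ≡⟨ lookup-section j γ i ⟨
          lookup (section j γ) i                        ≤⟨ sec≤ i ⟩
          toℕ a ℕ.* E ℕ.+ E                             ≡⟨ ℕP.+-comm _ E ⟩
          suc (toℕ a) ℕ.* E                             ≤⟨ ℕP.*-monoˡ-≤ E (FinP.toℕ<n a) ⟩
          q ℕ.* E                                       ∎)
      where open ℕP.≤-Reasoning

    Φ : Fin q → Matrix (q ℕ.^ (suc E ℕ.^ k)) (q ℕ.^ (suc E ℕ.^ k))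
    Φ a t s = ℤ∑.sum λ j → basis (step a s j) t

    initial : State
    initial = encode (coeff 1ᴾ)

    -- All states at once: passing from `n` to its quotient by `q` replaces g by the h_δ, so g = 1
    -- alone gives no closed recursion.
    counts : Carrier → ℕ → Vector ℤ (q ℕ.^ (suc E ℕ.^ k))
    counts α n s = + length (exponentsWith α (f ^ᴾ n *ᴾ decode s))

    module _ (q-pp : IsPrimePower q) {α} (α≉0 : α ≉ 0#) where

      -- Column `s` of `Φ a` is the sum of the basis vectors of the states h_δ, so pairing a row
      -- with it adds up the entries of the row at these states.
      counts-step : ∀ a m s → counts α (toℕ a ℕ.+ m ℕ.* q) s ≡ counts α m ∙ᵥ (λ t → Φ a t s)
      counts-step a m s = begin
        counts α (toℕ a ℕ.+ m ℕ.* q) s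
          ≡⟨ ≡.cong +_ (count-sections α≉0 (f ^ᴾ (toℕ a ℕ.+ m ℕ.* q) *ᴾ decode s) piece coeff-piece) ⟩
        + length (concat (tabulate λ j → List.map (section j) (exponentsWith α (piece j))))
          ≡⟨ +-length-concat (λ j → List.map (section j) (exponentsWith α (piece j))) ⟩
        ℤ∑.sum (λ j → + length (List.map (section j) (exponentsWith α (piece j))))
          ≡⟨ ℤ∑.sum-cong-≗ (λ j → ≡.cong +_ (ListP.length-map (section j) (exponentsWith α (piece j)))) ⟩
        ℤ∑.sum (λ j → counts α m (step a s j))
          ≡⟨ ℤ∑.sum-cong-≗ (λ j → ∙ᵥ-basis (counts α m) (step a s j)) ⟨
        ℤ∑.sum (λ j → counts α m ∙ᵥ basis (step a s j))
          ≡⟨ ∙ᵥ-sum (counts α m) (λ j → basis (step a s j)) ⟨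
        counts α m ∙ᵥ (λ t → Φ a t s)
          ∎
        where
        open ≡.≡-Reasoning
        piece : Fin (q ℕ.^ k) → Poly
        piece j = f ^ᴾ m *ᴾ decode (step a s j)
        coeff-piece : ∀ j γ → coeff (piece j) γ ≈
                              coeff (f ^ᴾ (toℕ a ℕ.+ m ℕ.* q) *ᴾ decode s) (section j γ)
        -- `f^m h_δ` is the section at δ of `f^m(x^q) f^a g`, which Frobenius identifies with
        -- `f^(a+mq) g`.
        coeff-piece j γ = trans
          (coeff-*ᴾ-transfer (scale q) (section j) (section-⊕ j) (section-∣ j)
            (f ^ᴾ toℕ a *ᴾ decode s) (decode (step a s j)) (coeff-step a s j) (f ^ᴾ m) γ)
          (sym (≋⇒coeff-≈ (^ᴾ-+-* q-pp f (toℕ a) m (decode s)) (section j γ)))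

      -- The column `w` is arbitrary because `digitAction` accumulates: removing the least
      -- significant digit leaves the row of the quotient and changes `w` into `Φ a *ᵥ w`. When the
      -- digits run out the quotient is 0, and the row left over is the vector u.
      counts-digits : ∀ as w → counts α (fromDigits as) ∙ᵥ w ≡ counts α 0 ∙ᵥ digitAction Φ as w
      counts-digits []       w = ≡.refl
      counts-digits (a ∷ as) w = begin
        counts α (toℕ a ℕ.+ fromDigits as ℕ.* q) ∙ᵥ w
          ≡⟨ ℤ∑.sum-cong-≗ (λ s → ≡.cong (ℤ._* w s) (counts-step a (fromDigits as) s)) ⟩
        (λ s → counts α (fromDigits as) ∙ᵥ (λ t → Φ a t s)) ∙ᵥ w
          ≡⟨ ∙ᵥ-*ᵥ (counts α (fromDigits as)) (Φ a) w ⟨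
        counts α (fromDigits as) ∙ᵥ (Φ a *ᵥ w)
          ≡⟨ counts-digits as (Φ a *ᵥ w) ⟩
        counts α 0 ∙ᵥ digitAction Φ as (Φ a *ᵥ w)
          ∎
        where open ≡.≡-Reasoning

      -- `decode initial` lists every exponent of the box, so it agrees with `1ᴾ` in coefficients
      -- but in general not as a list.
      counts-initial : ∀ n → counts α n initial ≡ + N f α n
      counts-initial n = ≡.cong +_ (count-cong α≉0 (f ^ᴾ n *ᴾ decode initial) (f ^ᴾ n) λ γ → trans
        (coeff-*ᴾ-congʳ 1ᴾ (decode initial)
          (coeff-decode-encode (coeff 1ᴾ) (coeff-unbounded (degreeBound-1ᴾ E))) (f ^ᴾ n) γ)
        (≋⇒coeff-≈ (CommutativeSemiring.*-identityʳ polynomialSemiring (f ^ᴾ n)) γ))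

      N-digits : ∀ as → + N f α (fromDigits as) ≡ counts α 0 ∙ᵥ digitAction Φ as (basis initial)
      N-digits as = begin
        + N f α (fromDigits as)                        ≡⟨ counts-initial (fromDigits as) ⟨
        counts α (fromDigits as) initial               ≡⟨ ∙ᵥ-basis (counts α (fromDigits as)) initial ⟨
        counts α (fromDigits as) ∙ᵥ basis initial      ≡⟨ counts-digits as (basis initial) ⟩
        counts α 0 ∙ᵥ digitAction Φ as (basis initial) ∎
        where open ≡.≡-Reasoning

-- A degree bound for f, and the conclusion.

lookup-≤-sum : ∀ {k} (γ : Vec ℕ k) i → lookup γ i ≤ Vec.sum γ
lookup-≤-sum (x ∷ γ) Fin.zero    = ℕP.m≤m+n x _
lookup-≤-sum (x ∷ γ) (Fin.suc i) = ℕP.≤-trans (lookup-≤-sum γ i) (ℕP.m≤n+m _ x)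

-- The largest total degree of a listed term: a crude bound on single exponents, but its value
-- affects only the size of the matrices.
maxDegree : ∀ {a} {A : Set a} {k} → List (A × Vec ℕ k) → ℕ
maxDegree []            = 0
maxDegree ((a , γ) ∷ f) = Vec.sum γ ℕ.⊔ maxDegree f

maxDegree-bound : ∀ {a} {A : Set a} {k} (f : List (A × Vec ℕ k)) →
                  All (λ x → ∀ i → lookup (proj₂ x) i ≤ maxDegree f) f
maxDegree-bound []            = []
maxDegree-bound ((a , γ) ∷ f) =
  (λ i → ℕP.≤-trans (lookup-≤-sum γ i) (ℕP.m≤m⊔n _ _)) ∷
  All.map (λ δ≤ i → ℕP.≤-trans (δ≤ i) (ℕP.m≤n⊔m (Vec.sum γ) _)) (maxDegree-bound f)

theorem2p1 : ∀ {c ℓ : Level} (q : ℕ) → IsPrimePower q →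
    (F : FiniteField c ℓ q) (k : ℕ) → 1 ≤ k →
    (f : Polynomials.Poly F k) →
    Σ[ d ∈ ℕ ] Σ[ Φ ∈ (Fin q → Matrix d d) ] Σ[ v ∈ Vector ℤ d ]
    ((α : FiniteField.Carrier F) → FiniteField._≉_ F α (FiniteField.0# F) →
    Σ[ u ∈ Vector ℤ d ]
    ((n : ℕ) → 1 ≤ n → (as : Expansion q) → fromDigits as ≡ n →
    + Polynomials.N F k f α n ≡ u ∙ᵥ digitAction Φ as v))
theorem2p1 q q-pp F k 1≤k f =
  -- States, transitions and the initial state are built from `f` alone; `α` enters only through the
  -- row `counts α 0`.
  q ℕ.^ (suc (maxDegree f) ℕ.^ k) , Φ , basis initial , λ α α≉0 → counts α 0 ,
    λ { _ _ as ≡.refl → N-digits q-pp α≉0 as }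
  where
  open States F k (maxDegree f)
  open Transitions f (maxDegree-bound f)
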